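{- Let $S$ be a $(v, e, \lambda_{rr}, -, \lambda_{rc} : r \times c)$ sesqui array on symbols $s_1,\dots,s_v$, and let $m$ be a positive integer. Let $S_1,\dots,S_v$ be pairwise disjoint sets of symbols with $|S_i|=m$ for all $i$. Let $A$ be any $r\times mc$ array obtained from $S$ by replacing each cell of $S$ by a $1\times m$ row of cells, where each cell containing $s_i$ is replaced by a row containing every symbol of $S_i$ exactly once, in an arbitrary order (the order may be different for different occurrences of $s_i$). Then $A$ is an $r\times mc$ sesqui array (on $mv$ symbols) with constant row-row intersection size $m\lambda_{rr}$, constant row-column intersection size $\lambda_{rc}$, and replication number $e$. Moreover, if $m\ge 2$ and $e \geq 2$, then the sesqui array $A$ is proper.
   Context: A row-column design is an $r\times c$ array filled with symbols from a set of $v$ symbols such that no symbol occurs more than once in any row or in any column (binary), and every symbol occurs exactly $e$ times in the array (equireplicate with replication number $e$). Consider the following possible properties, where rows and columns are identified with their symbol sets: (RR) any two distinct rows have exactly $\lambda_{rr}$ common symbols; (CC) any two distinct columns have exactly $\lambda_{cc}$ common symbols (for some constant $\lambda_{cc}$); (RC) any row and any column have exactly $\lambda_{rc}$ common symbols. A $(v, e, \lambda_{rr}, -, \lambda_{rc}: r \times c)$ sesqui array is an $r\times c$ row-column design on $v$ symbols with replication number $e$ satisfying (RR) and (RC). It is proper if (CC) does not hold for any constant. A sesqui array with $v=\max\{r,c\}$ (e.g. a Latin rectangle) is allowed as the input $S$. -}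

module Defs where

open import Algebra.Properties.CommutativeMonoid.Sum using (sum)
open import Data.Fin using (Fin; combine; _≟_)
open import Data.Fin.Properties using (any?)
open import Data.Fin.Subset using (Subset; ∣_∣; _∩_; _∈_; Empty)
open import Data.Nat using (ℕ; _*_; _≤_)
open import Data.Nat.Properties using (+-0-commutativeMonoid)
open import Data.Product using (∃; ∃!; _×_)
open import Data.Vec using (tabulate)
open import Function.Definitions using (Injective)
open import Level using (Level)
open import Relation.Binary.PropositionalEquality using (_≡_; _≢_)
open import Relation.Nullary using (¬_; does)
open import Relation.Unary using (Pred; Decidable)

private
  variable
    ℓ : Level
    m n r c v : ℕ

Array : ℕ → ℕ → ℕ → Set
Array r c v = Fin r → Fin c → Fin v

-- The subset { x | P x }.
⟪_⟫ : {P : Pred (Fin n) ℓ} → Decidable P → Subset n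
⟪ P? ⟫ = tabulate (λ x → does (P? x))

rowSet : Array r c v → Fin r → Subset v
rowSet A i = ⟪ (λ s → any? (λ j → A i j ≟ s)) ⟫

colSet : Array r c v → Fin c → Subset v
colSet A j = ⟪ (λ s → any? (λ i → A i j ≟ s)) ⟫

-- The number of cells containing s, counted row by row.
occurrences : Array r c v → Fin v → ℕ
occurrences A s =
  sum +-0-commutativeMonoid (λ i → ∣ ⟪ (λ j → A i j ≟ s) ⟫ ∣)

-- Arrays are required to be nonempty.  An array without cells has
-- symbol set Fin 0 and satisfies every replication condition vacuously.
record IsRowColumnDesign (e : ℕ) (A : Array r c v) : Set where
  field
    rows-nonempty : 1 ≤ r
    cols-nonempty : 1 ≤ c
    row-binary    : ∀ i → Injective _≡_ _≡_ (λ j → A i j)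
    col-binary    : ∀ j → Injective _≡_ _≡_ (λ i → A i j)
    equireplicate : ∀ s → occurrences A s ≡ e

RR : ℕ → Array r c v → Set
RR λrr A = ∀ i i′ → i ≢ i′ → ∣ rowSet A i ∩ rowSet A i′ ∣ ≡ λrr

CC : ℕ → Array r c v → Set
CC λcc A = ∀ j j′ → j ≢ j′ → ∣ colSet A j ∩ colSet A j′ ∣ ≡ λcc

RC : ℕ → Array r c v → Set
RC λrc A = ∀ i j → ∣ rowSet A i ∩ colSet A j ∣ ≡ λrc

record IsSesquiArray (v e λrr λrc r c : ℕ) (A : Array r c v) : Set where
  field
    isRowColumnDesign : IsRowColumnDesign e A
    rr                : RR λrr A
    rc                : RC λrc A

IsProper : Array r c v → Set
IsProper A = ¬ (∃ λ λcc → CC λcc A)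

PairwiseDisjoint : (Fin v → Subset n) → Set
PairwiseDisjoint T = ∀ k k′ → k ≢ k′ → Empty (T k ∩ T k′)

-- T k is the set of symbols replacing the symbol k of S.  Cell (i , j) of
-- S is replaced by the cells (i , combine j a) for a : Fin m, that is, by
-- the m consecutive cells of row i in columns j * m , … , j * m + (m - 1).
-- The row of m cells contains each element of T (S i j) exactly once;
-- if ∣ T (S i j) ∣ ≡ m, this leaves no room for other symbols.
IsReplacement : (S : Array r c v) (T : Fin v → Subset n) →
                Array r (c * m) n → Set
IsReplacement {m = m} S T A =
  ∀ i j x → x ∈ T (S i j) → ∃! _≡_ λ (a : Fin m) → A i (combine j a) ≡ x

{-# OPTIONS --safe #-}

-- Disjointness and ∣ T k ∣ ≡ m make the sets T k a partition of the m * v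
-- symbols, and the m cells replacing an occurrence of k carry exactly T k.
-- Every cardinality in A then follows from the corresponding one in S by
-- counting fibres: a row-row intersection is the union of the T k over the
-- intersection in S, a row-column intersection meets each T k in exactly one
-- symbol, and a symbol of T k occurs in a row exactly as often as k does.
-- Two columns of the same block have no common symbol, so A could only have
-- constant column-column intersection size 0; but a symbol occurring twice
-- lies in two different columns.

module Submission where

open import Defs
open import Algebra.Properties.CommutativeMonoid.Sum using (sum; sum-cong-≗)
open import Data.Empty using (⊥-elim)
open import Data.Fin using (Fin; zero; suc; combine; fromℕ<; quotient; _≟_)
open import Data.Fin.Properties
  using (any?; suc-injective; combine-injective; combine-surjective;
         remQuot-combine)
open import Data.Fin.Subset
  using (Subset; ∣_∣; _∩_; _∪_; _∈_; ⊥; ⊤; ⁅_⁆; inside; outside; Empty; Nonempty)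
open import Data.Fin.Subset.Properties
  using (∣⊥∣≡0; ∣⊤∣≡n; ∣⁅x⁆∣≡1; ∣p∣≡n⇒p≡⊤; p⊆q⇒∣p∣≤∣q∣; ∉⊥; ∈⊤; x∈⁅x⁆; x∈⁅y⁆⇒x≡y;
         x∈p∩q⁺; x∈p∩q⁻; x∈p∪q⁺; x∈p∪q⁻; ⊆-antisym; Empty-unique; nonempty?; _∈?_;
         drop-∷-Empty)
open import Data.Nat using (ℕ; zero; suc; _+_; _*_; _≤_; z≤n; s≤s; s≤s⁻¹)
open import Data.Nat.Properties
  using (+-0-commutativeMonoid; +-suc; *-comm; *-identityʳ; *-mono-≤; n≮0)
open import Data.Product using (∃; ∃₂; _×_; _,_; proj₁; proj₂)
open import Data.Sum using (inj₁; inj₂)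
open import Data.Vec using ([]; _∷_; here; there)
open import Data.Vec.Properties using (lookup⇒[]=; []=⇒lookup; lookup∘tabulate)
open import Function using (_∘_)
open import Level using (Level)
open import Relation.Binary.PropositionalEquality
  using (_≡_; _≢_; refl; sym; trans; cong; cong₂; subst; module ≡-Reasoning)
open import Relation.Nullary using (yes; no; contradiction; does)
open import Relation.Nullary.Decidable using (dec-true; _×-dec_; decidable-stable)
open import Relation.Unary using (Pred; Decidable)

private
  variable
    ℓ : Level
    n r c v m : ℕ
    p : Subset n

-- Membership in decidable subsets, row sets and column sets.

module _ {P : Pred (Fin n) ℓ} (P? : Decidable P) where

  ∈⟪⟫⁺ : ∀ {x} → P x → x ∈ ⟪ P? ⟫
  ∈⟪⟫⁺ {x} px =
    lookup⇒[]= x _ (trans (lookup∘tabulate (does ∘ P?) x) (dec-true (P? x) px))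

  ∈⟪⟫⁻ : ∀ {x} → x ∈ ⟪ P? ⟫ → P x
  ∈⟪⟫⁻ {x} x∈ with P? x | trans (sym (lookup∘tabulate (does ∘ P?) x)) ([]=⇒lookup x∈)
  ... | yes px | _  = px
  ... | no _   | ()

∈rowSet⁺ : ∀ (A : Array r c v) i j {s} → A i j ≡ s → s ∈ rowSet A i
∈rowSet⁺ A i j eq = ∈⟪⟫⁺ (λ s → any? (λ j → A i j ≟ s)) (j , eq)

∈rowSet⁻ : ∀ (A : Array r c v) i {s} → s ∈ rowSet A i → ∃ λ j → A i j ≡ s
∈rowSet⁻ A i = ∈⟪⟫⁻ (λ s → any? (λ j → A i j ≟ s))

∈colSet⁺ : ∀ (A : Array r c v) i j {s} → A i j ≡ s → s ∈ colSet A j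
∈colSet⁺ A i j eq = ∈⟪⟫⁺ (λ s → any? (λ i → A i j ≟ s)) (i , eq)

∈colSet⁻ : ∀ (A : Array r c v) j {s} → s ∈ colSet A j → ∃ λ i → A i j ≡ s
∈colSet⁻ A j = ∈⟪⟫⁻ (λ s → any? (λ i → A i j ≟ s))

-- Cardinalities of empty, inhabited and one-element subsets.

Empty⇒∣p∣≡0 : ∀ {p : Subset n} → Empty p → ∣ p ∣ ≡ 0
Empty⇒∣p∣≡0 {n} e = trans (cong ∣_∣ (Empty-unique e)) (∣⊥∣≡0 n)

x∈p⇒1≤∣p∣ : ∀ {x} → x ∈ p → 1 ≤ ∣ p ∣
x∈p⇒1≤∣p∣ {p = p} {x} x∈p = subst (_≤ ∣ p ∣) (∣⁅x⁆∣≡1 x)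
  (p⊆q⇒∣p∣≤∣q∣ (λ y∈ → subst (_∈ p) (sym (x∈⁅y⁆⇒x≡y x y∈)) x∈p))

1≤∣p∣⇒Nonempty : 1 ≤ ∣ p ∣ → Nonempty p
1≤∣p∣⇒Nonempty {p = p} 1≤ with nonempty? p
... | yes ne = ne
... | no ¬ne = ⊥-elim (n≮0 (subst (1 ≤_) (Empty⇒∣p∣≡0 ¬ne) 1≤))

∣subsingleton∣≤1 : (∀ {x y} → x ∈ p → y ∈ p → x ≡ y) → ∣ p ∣ ≤ 1
∣subsingleton∣≤1 {p = p} uniq with nonempty? p
... | no ¬ne        = subst (_≤ 1) (sym (Empty⇒∣p∣≡0 ¬ne)) z≤n
... | yes (x , x∈p) = subst (∣ p ∣ ≤_) (∣⁅x⁆∣≡1 x)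
  (p⊆q⇒∣p∣≤∣q∣ (λ y∈p → subst (_∈ ⁅ x ⁆) (uniq x∈p y∈p) (x∈⁅x⁆ x)))

∣singleton∣≡1 : ∀ {x} → x ∈ p → (∀ {y} → y ∈ p → x ≡ y) → ∣ p ∣ ≡ 1
∣singleton∣≡1 {p = p} {x} x∈p uniq = trans (cong ∣_∣ p≡⁅x⁆) (∣⁅x⁆∣≡1 x)
  where
  p≡⁅x⁆ : p ≡ ⁅ x ⁆
  p≡⁅x⁆ = ⊆-antisym (λ y∈p → subst (_∈ ⁅ x ⁆) (uniq y∈p) (x∈⁅x⁆ x))
                    (λ y∈ → subst (_∈ p) (sym (x∈⁅y⁆⇒x≡y x y∈)) x∈p)

-- Disjoint unions and counting by fibres.

disjoint⇒∣p∪q∣≡∣p∣+∣q∣ : ∀ (p q : Subset n) → Empty (p ∩ q) → ∣ p ∪ q ∣ ≡ ∣ p ∣ + ∣ q ∣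
disjoint⇒∣p∪q∣≡∣p∣+∣q∣ []            []            _ = refl
disjoint⇒∣p∪q∣≡∣p∣+∣q∣ (inside ∷ p)  (inside ∷ q)  e = contradiction (zero , here) e
disjoint⇒∣p∪q∣≡∣p∣+∣q∣ (inside ∷ p)  (outside ∷ q) e =
  cong suc (disjoint⇒∣p∪q∣≡∣p∣+∣q∣ p q (drop-∷-Empty e))
disjoint⇒∣p∪q∣≡∣p∣+∣q∣ (outside ∷ p) (inside ∷ q)  e =
  trans (cong suc (disjoint⇒∣p∪q∣≡∣p∣+∣q∣ p q (drop-∷-Empty e))) (sym (+-suc ∣ p ∣ ∣ q ∣))
disjoint⇒∣p∪q∣≡∣p∣+∣q∣ (outside ∷ p) (outside ∷ q) e =
  disjoint⇒∣p∪q∣≡∣p∣+∣q∣ p q (drop-∷-Empty e)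

⋃ : Subset v → (Fin v → Subset n) → Subset n
⋃ []            R = ⊥
⋃ (inside ∷ K)  R = R zero ∪ ⋃ K (R ∘ suc)
⋃ (outside ∷ K) R = ⋃ K (R ∘ suc)

∈⋃⁺ : ∀ {K : Subset v} {R : Fin v → Subset n} {k x} → k ∈ K → x ∈ R k → x ∈ ⋃ K R
∈⋃⁺ {K = inside ∷ _}  here       x∈ = x∈p∪q⁺ (inj₁ x∈)
∈⋃⁺ {K = inside ∷ _}  (there k∈) x∈ = x∈p∪q⁺ (inj₂ (∈⋃⁺ k∈ x∈))
∈⋃⁺ {K = outside ∷ _} (there k∈) x∈ = ∈⋃⁺ k∈ x∈

∈⋃⁻ : ∀ (K : Subset v) (R : Fin v → Subset n) {x} → x ∈ ⋃ K R → ∃ λ k → k ∈ K × x ∈ R k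
∈⋃⁻ []            R x∈ = ⊥-elim (∉⊥ x∈)
∈⋃⁻ (inside ∷ K)  R x∈ with x∈p∪q⁻ (R zero) _ x∈
... | inj₁ x∈R₀ = zero , here , x∈R₀
... | inj₂ x∈⋃  = let k , k∈ , x∈R = ∈⋃⁻ K (R ∘ suc) x∈⋃ in suc k , there k∈ , x∈R
∈⋃⁻ (outside ∷ K) R x∈ = let k , k∈ , x∈R = ∈⋃⁻ K (R ∘ suc) x∈ in suc k , there k∈ , x∈R

PairwiseDisjoint⇒≡ : ∀ {R : Fin v → Subset n} → PairwiseDisjoint R →
                     ∀ {k k′ x} → x ∈ R k → x ∈ R k′ → k ≡ k′
PairwiseDisjoint⇒≡ disj {k} {k′} {x} x∈ x∈′ =
  decidable-stable (k ≟ k′) λ k≢k′ → disj k k′ k≢k′ (x , x∈p∩q⁺ (x∈ , x∈′))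

∣⋃∣ : ∀ (K : Subset v) (R : Fin v → Subset n) → PairwiseDisjoint R →
      (∀ {k} → k ∈ K → ∣ R k ∣ ≡ m) → ∣ ⋃ K R ∣ ≡ ∣ K ∣ * m
∣⋃∣ {n = n} []      R disj size = ∣⊥∣≡0 n
∣⋃∣ (inside ∷ K)  R disj size = trans
  (disjoint⇒∣p∪q∣≡∣p∣+∣q∣ (R zero) _ λ (x , x∈) →
    let x∈₀ , x∈⋃ = x∈p∩q⁻ (R zero) _ x∈
        k , _ , x∈R = ∈⋃⁻ K (R ∘ suc) x∈⋃
    in contradiction (PairwiseDisjoint⇒≡ disj x∈₀ x∈R) λ ())
  (cong₂ _+_ (size here)
    (∣⋃∣ K (R ∘ suc) (λ k k′ k≢k′ → disj (suc k) (suc k′) (k≢k′ ∘ suc-injective))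
         (size ∘ there)))
∣⋃∣ (outside ∷ K) R disj size =
  ∣⋃∣ K (R ∘ suc) (λ k k′ k≢k′ → disj (suc k) (suc k′) (k≢k′ ∘ suc-injective))
      (size ∘ there)

-- The main counting tool: the sets `R k` over `k ∈ K` partition `p`, so `p` has `m` elements per
-- index. With `m` equal to 1 it transfers a cardinality unchanged. The size is asked only for
-- `k ∈ K`, since a fibre such as `T k ∩ column` may be empty for other `k`.
count-fibres : ∀ (p : Subset n) (K : Subset v) (R : Fin v → Subset n) →
               PairwiseDisjoint R →
               (∀ {k} → k ∈ K → ∣ R k ∣ ≡ m) →
               (∀ {x} → x ∈ p → ∃ λ k → k ∈ K × x ∈ R k) →
               (∀ {k x} → k ∈ K → x ∈ R k → x ∈ p) →
               ∣ p ∣ ≡ ∣ K ∣ * m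
count-fibres p K R disj size split merge = trans
  (cong ∣_∣ (⊆-antisym (λ x∈p → let k , k∈ , x∈R = split x∈p in ∈⋃⁺ k∈ x∈R)
                       (λ x∈⋃ → let k , k∈ , x∈R = ∈⋃⁻ K R x∈⋃ in merge k∈ x∈R)))
  (∣⋃∣ K R disj size)

-- Sums of row counts and symbols that occur twice.

∑ : (Fin n → ℕ) → ℕ
∑ = sum +-0-commutativeMonoid

1≤∑⇒positive : ∀ (f : Fin n → ℕ) → 1 ≤ ∑ f → ∃ λ i → 1 ≤ f i
1≤∑⇒positive {suc n} f 1≤ with f zero in eq
... | suc _ = zero , subst (1 ≤_) (sym eq) (s≤s z≤n)
... | zero  = let i , 1≤fi = 1≤∑⇒positive (f ∘ suc) 1≤ in suc i , 1≤fi

2≤∑⇒two-positive : ∀ (f : Fin n → ℕ) → (∀ i → f i ≤ 1) → 2 ≤ ∑ f →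
                   ∃₂ λ i i′ → i ≢ i′ × 1 ≤ f i × 1 ≤ f i′
2≤∑⇒two-positive {suc n} f f≤1 2≤ with f zero in eq | f≤1 zero
... | zero  | _       =
  let i , i′ , i≢i′ , 1≤fi , 1≤fi′ = 2≤∑⇒two-positive (f ∘ suc) (f≤1 ∘ suc) 2≤
  in suc i , suc i′ , i≢i′ ∘ suc-injective , 1≤fi , 1≤fi′
-- This term is exactly 1, so the remaining terms still sum to at least 1.
... | suc _ | s≤s z≤n =
  let i , 1≤fi = 1≤∑⇒positive (f ∘ suc) (s≤s⁻¹ 2≤)
  in zero , suc i , (λ ()) , subst (1 ≤_) (sym eq) (s≤s z≤n) , 1≤fi

-- Row binarity bounds each row count by 1, so a total of at least 2 needs two different rows. Were
-- the two occurrences in one column, column binarity would identify these rows.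
repeated-symbol : ∀ {e} {A : Array r c v} → IsRowColumnDesign e A → 2 ≤ e → ∀ s →
                  ∃₂ λ j j′ → j ≢ j′ × s ∈ colSet A j × s ∈ colSet A j′
repeated-symbol {A = A} design 2≤e s =
  let i , i′ , i≢i′ , 1≤ , 1≤′ = 2≤∑⇒two-positive _ ≤1 (subst (2 ≤_) (sym (equireplicate s)) 2≤e)
      j  , j∈  = 1≤∣p∣⇒Nonempty 1≤
      j′ , j′∈ = 1≤∣p∣⇒Nonempty 1≤′
      eq  = ∈⟪⟫⁻ (λ j → A i  j ≟ s) j∈
      eq′ = ∈⟪⟫⁻ (λ j → A i′ j ≟ s) j′∈
  in j , j′
   , (λ j≡j′ → i≢i′ (col-binary j′ (trans (subst (λ j → A i j ≡ s) j≡j′ eq) (sym eq′))))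
   , ∈colSet⁺ A i j eq , ∈colSet⁺ A i′ j′ eq′
  where
  open IsRowColumnDesign design
  ≤1 : ∀ i → ∣ ⟪ (λ j → A i j ≟ s) ⟫ ∣ ≤ 1
  ≤1 i = ∣subsingleton∣≤1 λ j∈ j′∈ →
    row-binary i (trans (∈⟪⟫⁻ (λ j → A i j ≟ s) j∈) (sym (∈⟪⟫⁻ (λ j → A i j ≟ s) j′∈)))

-- Parts and blocks of the replacement array.

module Replacement
  {v e λrr λrc r c : ℕ} {S : Array r c v} (sesqui : IsSesquiArray v e λrr λrc r c S)
  {m : ℕ} {T : Fin v → Subset (m * v)}
  (disjoint : PairwiseDisjoint T) (size : ∀ k → ∣ T k ∣ ≡ m)
  {A : Array r (c * m) (m * v)} (replacement : IsReplacement {m = m} S T A)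
  where

  open IsSesquiArray sesqui
  open IsRowColumnDesign isRowColumnDesign

  part-unique : ∀ {k k′ x} → x ∈ T k → x ∈ T k′ → k ≡ k′
  part-unique = PairwiseDisjoint⇒≡ disjoint

  -- The `v` disjoint parts of size `m` have `m * v` elements together, which exhausts the symbol
  -- set.
  part : ∀ x → ∃ λ k → x ∈ T k
  part x = let k , _ , x∈T = ∈⋃⁻ ⊤ T (subst (x ∈_) (sym ⋃≡⊤) ∈⊤) in k , x∈T
    where
    open ≡-Reasoning
    ⋃≡⊤ : ⋃ ⊤ T ≡ ⊤
    ⋃≡⊤ = ∣p∣≡n⇒p≡⊤ (begin
      ∣ ⋃ ⊤ T ∣      ≡⟨ ∣⋃∣ ⊤ T disjoint (λ {k} _ → size k) ⟩
      ∣ ⊤ {v} ∣ * m  ≡⟨ cong (_* m) (∣⊤∣≡n v) ⟩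
      v * m          ≡⟨ *-comm v m ⟩
      m * v          ∎)

  -- The positions in the block that carry a symbol of T (S i j) are as many as
  -- these symbols, that is m, so they are all positions.
  cell∈part : ∀ i j a → A i (combine j a) ∈ T (S i j)
  cell∈part i j a = ∈⟪⟫⁻ hits? (subst (a ∈_) (sym hits≡⊤) ∈⊤)
    where
    open ≡-Reasoning
    K = T (S i j)
    hits? : Decidable (λ a → A i (combine j a) ∈ K)
    hits? a = A i (combine j a) ∈? K
    carries? : ∀ x → Decidable (λ a → A i (combine j a) ≡ x)
    carries? x a = A i (combine j a) ≟ x
    hits≡⊤ : ⟪ hits? ⟫ ≡ ⊤
    hits≡⊤ = ∣p∣≡n⇒p≡⊤ (begin
      ∣ ⟪ hits? ⟫ ∣
        ≡⟨ count-fibres ⟪ hits? ⟫ K (λ x → ⟪ carries? x ⟫)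
             (λ x y x≢y (a , a∈) →
               let a∈x , a∈y = x∈p∩q⁻ ⟪ carries? x ⟫ ⟪ carries? y ⟫ a∈
               in x≢y (trans (sym (∈⟪⟫⁻ (carries? x) a∈x)) (∈⟪⟫⁻ (carries? y) a∈y)))
             (λ {x} x∈K →
               let a , eq , uniq = replacement i j x x∈K
               in ∣singleton∣≡1 (∈⟪⟫⁺ (carries? x) eq) (λ b∈ → uniq (∈⟪⟫⁻ (carries? x) b∈)))
             (λ {a} a∈ → A i (combine j a) , ∈⟪⟫⁻ hits? a∈ , ∈⟪⟫⁺ (carries? _) refl)
             (λ {x} x∈K a∈ → ∈⟪⟫⁺ hits? (subst (_∈ K) (sym (∈⟪⟫⁻ (carries? x) a∈)) x∈K)) ⟩
      ∣ K ∣ * 1  ≡⟨ *-identityʳ _ ⟩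
      ∣ K ∣      ≡⟨ size (S i j) ⟩
      m          ∎)

  -- Reads the entry of `S` back from a block of `A`: the cell carries a symbol of `T (S i j)`, and
  -- a symbol lies in one part only.
  cell-part : ∀ i j a {k x} → A i (combine j a) ≡ x → x ∈ T k → S i j ≡ k
  cell-part i j a eq x∈ = part-unique (subst (_∈ T (S i j)) eq (cell∈part i j a)) x∈

  block-injective : ∀ i j {a b} → A i (combine j a) ≡ A i (combine j b) → a ≡ b
  block-injective i j {a} {b} eq =
    let _ , _ , uniq = replacement i j (A i (combine j b)) (cell∈part i j b)
    in trans (sym (uniq eq)) (uniq refl)

  A-row-binary : ∀ i {l l′} → A i l ≡ A i l′ → l ≡ l′
  A-row-binary i {l} {l′} eq
    with j , a , refl ← combine-surjective {c} {m} l
       | j′ , b , refl ← combine-surjective {c} {m} l′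
    -- A symbol shared by two blocks of a row forces equal entries of `S` there, so the two blocks
    -- coincide.
    with refl ← row-binary i (cell-part i j a eq (cell∈part i j′ b))
    = cong (combine j) (block-injective i j eq)

  -- A shared symbol forces equal entries in column `j` of `S`, hence the same row, and then the
  -- same position in one block. Equal `a` and `b` give column binarity; distinct ones give the
  -- disjoint columns behind properness.
  block-column-disjoint : ∀ {i i′} j a b → A i (combine j a) ≡ A i′ (combine j b) →
                          i ≡ i′ × a ≡ b
  block-column-disjoint {i} {i′} j a b eq
    with refl ← col-binary j (cell-part i j a eq (cell∈part i′ j b))
    = refl , block-injective i j eq

  A-col-binary : ∀ l {i i′} → A i l ≡ A i′ l → i ≡ i′
  A-col-binary l eq with j , a , refl ← combine-surjective {c} {m} l
    = proj₁ (block-column-disjoint j a a eq)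

  -- Row-row and row-column intersections.

  row⁺ : ∀ i {k x} → k ∈ rowSet S i → x ∈ T k → x ∈ rowSet A i
  row⁺ i {x = x} k∈ x∈ with j , refl ← ∈rowSet⁻ S i k∈ =
    let a , eq , _ = replacement i j x x∈ in ∈rowSet⁺ A i (combine j a) eq

  row⁻ : ∀ i {k x} → x ∈ rowSet A i → x ∈ T k → k ∈ rowSet S i
  row⁻ i x∈A x∈T with l , eq ← ∈rowSet⁻ A i x∈A
    with j , a , refl ← combine-surjective {c} {m} l
    = ∈rowSet⁺ S i j (cell-part i j a eq x∈T)

  -- Unlike for rows, the converse fails in general: when `k` is in column `j` of `S`, a row
  -- containing `k` receives all of `T k`, but a column of the block only one symbol of it.
  col⁻ : ∀ j a {k x} → x ∈ colSet A (combine j a) → x ∈ T k → k ∈ colSet S j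
  col⁻ j a x∈A x∈T with i , eq ← ∈colSet⁻ A (combine j a) x∈A
    = ∈colSet⁺ S i j (cell-part i j a eq x∈T)

  A-rr : RR (m * λrr) A
  A-rr i i′ i≢i′ = begin
    ∣ rowSet A i ∩ rowSet A i′ ∣
      ≡⟨ count-fibres _ (rowSet S i ∩ rowSet S i′) T disjoint (λ {k} _ → size k)
           (λ {x} x∈ →
             let k , x∈T = part x
                 x∈i , x∈i′ = x∈p∩q⁻ (rowSet A i) (rowSet A i′) x∈
             in k , x∈p∩q⁺ (row⁻ i x∈i x∈T , row⁻ i′ x∈i′ x∈T) , x∈T)
           (λ k∈ x∈T →
             let k∈i , k∈i′ = x∈p∩q⁻ (rowSet S i) (rowSet S i′) k∈
             in x∈p∩q⁺ (row⁺ i k∈i x∈T , row⁺ i′ k∈i′ x∈T)) ⟩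
    ∣ rowSet S i ∩ rowSet S i′ ∣ * m  ≡⟨ cong (_* m) (rr i i′ i≢i′) ⟩
    λrr * m                           ≡⟨ *-comm λrr m ⟩
    m * λrr                           ∎
    where open ≡-Reasoning

  -- Column binarity of `S` leaves a single row with `k` in column `j`, and only the cell in that
  -- row can carry a symbol of `T k`.
  ∣part∩column∣≡1 : ∀ j a {k} → k ∈ colSet S j → ∣ T k ∩ colSet A (combine j a) ∣ ≡ 1
  ∣part∩column∣≡1 j a k∈ with i , refl ← ∈colSet⁻ S j k∈ =
    ∣singleton∣≡1 (x∈p∩q⁺ (cell∈part i j a , ∈colSet⁺ A i (combine j a) refl)) unique
    where
    unique : ∀ {y} → y ∈ T (S i j) ∩ colSet A (combine j a) → A i (combine j a) ≡ y
    unique y∈ =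
      let y∈T , y∈col = x∈p∩q⁻ (T (S i j)) _ y∈
          i′ , eq     = ∈colSet⁻ A (combine j a) y∈col
          i′≡i        = col-binary j (cell-part i′ j a eq y∈T)
      in trans (cong (λ i → A i (combine j a)) (sym i′≡i)) eq

  A-rc : RC λrc A
  A-rc i l with j , a , refl ← combine-surjective {c} {m} l = begin
    ∣ rowSet A i ∩ column ∣
      -- The fibres are the parts cut down to the chosen column; each relevant one has a single
      -- symbol, so no factor `m` appears.
      ≡⟨ count-fibres _ (rowSet S i ∩ colSet S j) (λ k → T k ∩ column)
           (λ k k′ k≢k′ (x , x∈) →
             let x∈k , x∈k′ = x∈p∩q⁻ (T k ∩ column) (T k′ ∩ column) x∈
             in k≢k′ (part-unique (proj₁ (x∈p∩q⁻ (T k) column x∈k))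
                                  (proj₁ (x∈p∩q⁻ (T k′) column x∈k′))))
           (λ k∈ → ∣part∩column∣≡1 j a (proj₂ (x∈p∩q⁻ (rowSet S i) (colSet S j) k∈)))
           (λ {x} x∈ →
             let k , x∈T = part x
                 x∈row , x∈col = x∈p∩q⁻ (rowSet A i) column x∈
             in k , x∈p∩q⁺ (row⁻ i x∈row x∈T , col⁻ j a x∈col x∈T)
                  , x∈p∩q⁺ (x∈T , x∈col))
           (λ {k} k∈ x∈ →
             let k∈row , _ = x∈p∩q⁻ (rowSet S i) (colSet S j) k∈
                 x∈T , x∈col = x∈p∩q⁻ (T k) column x∈
             in x∈p∩q⁺ (row⁺ i k∈row x∈T , x∈col)) ⟩
    ∣ rowSet S i ∩ colSet S j ∣ * 1  ≡⟨ *-identityʳ _ ⟩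
    ∣ rowSet S i ∩ colSet S j ∣      ≡⟨ rc i j ⟩
    λrc                              ∎
    where
    open ≡-Reasoning
    column = colSet A (combine j a)

  -- The cells of row `i` carrying `x` are grouped by block: each block replacing a `k` holds `x`
  -- once, the others never.
  row-occurrences : ∀ i {k x} → x ∈ T k →
                    ∣ ⟪ (λ l → A i l ≟ x) ⟫ ∣ ≡ ∣ ⟪ (λ j → S i j ≟ k) ⟫ ∣
  row-occurrences i {k} {x} x∈T = trans
    (count-fibres _ ⟪ isK? ⟫ (λ j → ⟪ inBlock? j ⟫)
      (λ j j′ j≢j′ (l , l∈) →
        let l∈j , l∈j′ = x∈p∩q⁻ ⟪ inBlock? j ⟫ ⟪ inBlock? j′ ⟫ l∈
        in j≢j′ (trans (sym (proj₁ (∈⟪⟫⁻ (inBlock? j) l∈j))) (proj₁ (∈⟪⟫⁻ (inBlock? j′) l∈j′))))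
      single
      (λ {l} l∈ → split l (∈⟪⟫⁻ isX? l∈))
      (λ {j} _ l∈ → ∈⟪⟫⁺ isX? (proj₂ (∈⟪⟫⁻ (inBlock? j) l∈))))
    (*-identityʳ _)
    where
    isK? : Decidable (λ j → S i j ≡ k)
    isK? j = S i j ≟ k
    isX? : Decidable (λ l → A i l ≡ x)
    isX? l = A i l ≟ x
    -- `quotient m l` recovers the block index of the flat column `l`, so fibres for different `j`
    -- are disjoint at once.
    inBlock? : ∀ j → Decidable (λ l → quotient m l ≡ j × A i l ≡ x)
    inBlock? j l = quotient m l ≟ j ×-dec A i l ≟ x
    quotient-combine : ∀ j a → quotient m (combine {c} {m} j a) ≡ j
    quotient-combine j a = cong proj₁ (remQuot-combine j a)
    single : ∀ {j} → j ∈ ⟪ isK? ⟫ → ∣ ⟪ inBlock? j ⟫ ∣ ≡ 1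
    single {j} j∈ with refl ← ∈⟪⟫⁻ isK? j∈ =
      let a , eq , _ = replacement i j x x∈T
      in ∣singleton∣≡1 (∈⟪⟫⁺ (inBlock? j) (quotient-combine j a , eq))
           (λ l∈ → A-row-binary i (trans eq (sym (proj₂ (∈⟪⟫⁻ (inBlock? j) l∈)))))
    split : ∀ l → A i l ≡ x → ∃ λ j → j ∈ ⟪ isK? ⟫ × l ∈ ⟪ inBlock? j ⟫
    split l eq with j , a , refl ← combine-surjective {c} {m} l =
      j , ∈⟪⟫⁺ isK? (cell-part i j a eq x∈T) , ∈⟪⟫⁺ (inBlock? j) (quotient-combine j a , eq)

  A-equireplicate : ∀ x → occurrences A x ≡ e
  A-equireplicate x = let k , x∈T = part x in trans
    (sum-cong-≗ +-0-commutativeMonoid (λ i → row-occurrences i x∈T))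
    (equireplicate k)

  A-isRowColumnDesign : 1 ≤ c * m → IsRowColumnDesign e A
  A-isRowColumnDesign 1≤cm = record
    { rows-nonempty = rows-nonempty
    ; cols-nonempty = 1≤cm
    ; row-binary    = λ i → A-row-binary i
    ; col-binary    = λ l → A-col-binary l
    ; equireplicate = A-equireplicate
    }

  -- Properness.

  block-columns-disjoint : ∀ j {a b} → a ≢ b →
    Empty (colSet A (combine j a) ∩ colSet A (combine j b))
  block-columns-disjoint j {a} {b} a≢b (x , x∈) =
    let x∈a , x∈b = x∈p∩q⁻ (colSet A (combine j a)) _ x∈
        i  , eq   = ∈colSet⁻ A (combine j a) x∈a
        i′ , eq′  = ∈colSet⁻ A (combine j b) x∈b
    in a≢b (proj₂ (block-column-disjoint j a b (trans eq (sym eq′))))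

  A-isProper : IsRowColumnDesign e A → ∀ {a b : Fin m} → a ≢ b → 2 ≤ e → IsProper A
  A-isProper design {a} {b} a≢b 2≤e (λcc , cc) =
    let l , l′ , l≢l′ , x∈l , x∈l′ = repeated-symbol design 2≤e x
    in n≮0 (subst (1 ≤_) (trans (cc l l′ l≢l′) λcc≡0) (x∈p⇒1≤∣p∣ (x∈p∩q⁺ (x∈l , x∈l′))))
    where
    -- Nonemptiness of `S` supplies a block, whose columns `a` and `b` force the constant to be 0,
    -- and a symbol `x` to contradict this.
    j₀ = fromℕ< cols-nonempty
    x  = A (fromℕ< rows-nonempty) (combine j₀ a)
    λcc≡0 : λcc ≡ 0
    λcc≡0 = trans
      (sym (cc (combine j₀ a) (combine j₀ b)
              (λ eq → a≢b (proj₂ (combine-injective j₀ a j₀ b eq)))))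
      (Empty⇒∣p∣≡0 (block-columns-disjoint j₀ a≢b))

theorem4p2 : ∀ (v e λrr λrc r c : ℕ) (S : Array r c v) →
    IsSesquiArray v e λrr λrc r c S →
    ∀ (m : ℕ) → 1 ≤ m →
    (T : Fin v → Subset (m * v)) →
    PairwiseDisjoint T →
    (∀ k → ∣ T k ∣ ≡ m) →
    (A : Array r (c * m) (m * v)) →
    IsReplacement {m = m} S T A →
    IsSesquiArray (m * v) e (m * λrr) λrc r (c * m) A
    × (2 ≤ m → 2 ≤ e → IsProper A)
theorem4p2 v e λrr λrc r c S sesqui m 1≤m T disjoint size A replacement =
  record { isRowColumnDesign = design ; rr = A-rr ; rc = A-rc }
  -- Matching on `2 ≤ m` turns `m` into a double successor, so that `zero` and `suc zero` are
  -- distinct positions in a block.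
  , λ { (s≤s (s≤s _)) → A-isProper design {zero} {suc zero} (λ ()) }
  where
  open Replacement sesqui disjoint size {A} replacement
  open IsRowColumnDesign (IsSesquiArray.isRowColumnDesign sesqui) using (cols-nonempty)
  design : IsRowColumnDesign e A
  design = A-isRowColumnDesign (*-mono-≤ cols-nonempty 1≤m)
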